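{- Let $\mathcal{M}=(S,P,E,s_{init},L)$ be a CTMC, let $\varepsilon,\delta,\varepsilon_1,\delta_1,\varepsilon_2,\delta_2\geq 0$, and let $s,s',s''\in S$. (1) The relation $\sim_{\varepsilon,\delta}$ is the largest $(\varepsilon,\delta)$-bisimulation on $\mathcal{M}$, i.e. it is itself an $(\varepsilon,\delta)$-bisimulation and contains every $(\varepsilon,\delta)$-bisimulation on $\mathcal{M}$. (2) If $s\sim_{\varepsilon_1,\delta_1}s'$ and $s'\sim_{\varepsilon_2,\delta_2}s''$, then $s\sim_{\varepsilon_1+\varepsilon_2,\,\delta_1+\delta_2}s''$. (3) $s\sim s'$ if and only if $s\sim_{0,0}s'$.
   Context: A CTMC is a tuple $\mathcal{M}=(S,P,E,s_{init},L)$ with $S$ a finite nonempty set of states, $P\colon S\to\mathrm{Distr}(S)$ a transition probability function (self-loops allowed; write $P(s,s')=P(s)(s')$ and $P(s,A)=\sum_{a\in A}P(s,a)$ for $A\subseteq S$), $E\colon S\to\mathbb{R}_{>0}$ an exit rate function, $s_{init}\in S$ an initial state, and $L\colon S\to 2^{AP}$ a labeling function. For a relation $R\subseteq S\times S$ and $A\subseteq S$ let $R(A)=\{t\in S\mid \exists s\in A: (s,t)\in R\}$. For $\varepsilon,\delta\geq 0$, a reflexive and symmetric relation $R\subseteq S\times S$ is an $(\varepsilon,\delta)$-bisimulation if for all $(s,s')\in R$: (i) $L(s)=L(s')$; (ii) $|\ln E(s)-\ln E(s')|\leq\delta$; (iii) for all $A\subseteq S$, $P(s,A)\leq P(s',R(A))+\varepsilon$.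 States are $(\varepsilon,\delta)$-bisimilar, written $s\sim_{\varepsilon,\delta}s'$, if some $(\varepsilon,\delta)$-bisimulation contains $(s,s')$. A strong bisimulation is an equivalence relation $R$ on $S$ such that for all $(s,s')\in R$: $L(s)=L(s')$, $E(s)=E(s')$, and $P(s,C)=P(s',C)$ for every equivalence class $C$ of $R$; $s\sim s'$ means some strong bisimulation contains $(s,s')$. -}

module Defs where

open import Level using (0ℓ)
open import Algebra.Bundles using (CommutativeRing)
open import Data.Bool using (if_then_else_)
open import Data.Fin using (Fin)
open import Data.Fin.Properties using (any?)
open import Data.Fin.Subset using (Subset)
open import Data.Fin.Subset.Properties using (_∈?_)
open import Data.Nat using (ℕ)
open import Data.Product using (∃; _×_)
open import Data.Sum using ([_,_]′)
open import Data.Vec using (lookup; tabulate)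
open import Relation.Binary using (Rel; Reflexive; Symmetric; Decidable; IsEquivalence; IsTotalOrder)
open import Relation.Nullary using (¬_; does)
open import Relation.Nullary.Decidable using (_×-dec_)
open import Relation.Unary using (Pred; Satisfiable; _≐_)
import Algebra.Properties.CommutativeMonoid.Sum as Sum
import Relation.Binary.Construct.NonStrictToStrict as Strict

-- The real numbers: a complete ordered field, which is unique up to
-- isomorphism, with its natural logarithm.  `ln` is total, and only its
-- values on positive arguments are specified.  The fields `ln-*` and
-- `ln-≤` determine these: if f satisfies both, then
-- f x = k · f (x^(1/k)) ≤ k · (x^(1/k) - 1) for every k ≥ 1, and the right-hand
-- side tends to the natural logarithm of x; the same bound at 1/x
-- gives the reverse inequality.
record RealNumbers : Set₁ where
  field
    commutativeRing : CommutativeRing 0ℓ 0ℓ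

  open CommutativeRing commutativeRing public

  infix 4 _≤_

  field
    _≤_          : Rel Carrier 0ℓ
    isTotalOrder : IsTotalOrder _≈_ _≤_
    0≉1          : ¬ (0# ≈ 1#)
    inverse      : ∀ x → ¬ (x ≈ 0#) → ∃ λ y → x * y ≈ 1#
    +-monoˡ-≤    : ∀ z {x y} → x ≤ y → x + z ≤ y + z
    *-nonNeg     : ∀ {x y} → 0# ≤ x → 0# ≤ y → 0# ≤ x * y

  open Strict _≈_ _≤_ public using (_<_)

  IsUpperBound : Pred Carrier 0ℓ → Pred Carrier 0ℓ
  IsUpperBound A b = ∀ {x} → A x → x ≤ b

  IsSupremum : Pred Carrier 0ℓ → Pred Carrier 0ℓ
  IsSupremum A u = IsUpperBound A u × (∀ {b} → IsUpperBound A b → u ≤ b)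

  field
    complete : (A : Pred Carrier 0ℓ) → Satisfiable A →
               ∃ (IsUpperBound A) → ∃ (IsSupremum A)
    ln       : Carrier → Carrier
    ln-cong  : ∀ {x y} → x ≈ y → ln x ≈ ln y
    ln-*     : ∀ {x y} → 0# < x → 0# < y → ln (x * y) ≈ ln x + ln y
    ln-≤     : ∀ {x} → 0# < x → ln x ≤ x - 1#

  ∣_∣ : Carrier → Carrier
  ∣ x ∣ = [ (λ _ → x) , (λ _ → - x) ]′ (IsTotalOrder.total isTotalOrder 0# x)

  open Sum +-commutativeMonoid public using (sum)

record Distr (ℝ : RealNumbers) (n : ℕ) : Set where
  open RealNumbers ℝ
  field
    prob        : Fin n → Carrier
    prob-nonNeg : ∀ i → 0# ≤ prob i
    prob-sum    : sum prob ≈ 1#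

-- The state space is Fin size; it is nonempty because it contains init.
record CTMC (ℝ : RealNumbers) (AP : Set) : Set₁ where
  open RealNumbers ℝ
  field
    size  : ℕ

  State : Set
  State = Fin size

  field
    P     : State → Distr ℝ size
    E     : State → Carrier
    E-pos : ∀ s → 0# < E s
    init  : State
    L     : State → Pred AP 0ℓ

  Pr : State → Subset size → Carrier
  Pr s A = sum (λ t → if lookup A t then Distr.prob (P s) t else 0#)

image : ∀ {n r} {R : Rel (Fin n) r} → Decidable R → Subset n → Subset n
image R? A = tabulate λ t → does (any? λ s → (s ∈? A) ×-dec R? s t)

class : ∀ {n r} {R : Rel (Fin n) r} → Decidable R → Fin n → Subset n
class R? u = tabulate λ t → does (R? u t)

module Bisimulation {ℝ : RealNumbers} {AP : Set} (M : CTMC ℝ AP) where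
  open RealNumbers ℝ using (Carrier; _≈_; _≤_; _+_; _-_; ∣_∣; ln)
  open CTMC M

  -- Decidability of R is what makes R(A) and the classes of R subsets
  -- over which one can sum.  Under excluded middle it holds of every R.
  record IsApproxBisimulation {r} (ε δ : Carrier) (R : Rel State r) : Set r where
    field
      decidable : Decidable R
      reflexive : Reflexive R
      symmetric : Symmetric R
      labels    : ∀ {s s′} → R s s′ → L s ≐ L s′
      rates     : ∀ {s s′} → R s s′ → ∣ ln (E s) - ln (E s′) ∣ ≤ δ
      probs     : ∀ {s s′} → R s s′ → ∀ (A : Subset size) →
                  Pr s A ≤ Pr s′ (image decidable A) + ε

  _∼[_,_]_ : State → Carrier → Carrier → State → Set₁
  s ∼[ ε , δ ] s′ = ∃ λ (R : Rel State 0ℓ) → IsApproxBisimulation ε δ R × R s s′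

  record IsStrongBisimulation {r} (R : Rel State r) : Set r where
    field
      decidable     : Decidable R
      isEquivalence : IsEquivalence R
      labels        : ∀ {s s′} → R s s′ → L s ≐ L s′
      rates         : ∀ {s s′} → R s s′ → E s ≈ E s′
      probs         : ∀ {s s′} → R s s′ → ∀ u →
                      Pr s (class decidable u) ≈ Pr s′ (class decidable u)

  _∼_ : State → State → Set₁
  s ∼ s′ = ∃ λ (R : Rel State 0ℓ) → IsStrongBisimulation R × R s s′

  infix 4 _∼[_,_]_ _∼_

{-# OPTIONS --safe #-}

-- Since A ↦ P(s, A) and R ↦ R(A) are monotone, unions of (ε,δ)-bisimulations
-- are (ε,δ)-bisimulations, and R₁ ∘ R₂ ∪ R₂ ∘ R₁ is an (ε₁+ε₂,δ₁+δ₂)-bisimulation.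
-- If R is a strong bisimulation, then R(A) ⊇ A is a disjoint union of classes,
-- so P(s, A) ≤ P(s, R(A)) = P(s′, R(A)).  Conversely ∼[0,0] is transitive by
-- additivity, hence fixes its classes C, and P(s, C) ≤ P(s′, C) holds in both
-- directions; equality of the exit rates follows from injectivity of ln.
module Submission where

open import Defs
open import Level using (Level; 0ℓ)
open import Axiom.ExcludedMiddle using (ExcludedMiddle)
open import Data.Bool using (Bool; true; false; T; if_then_else_; _∨_)
open import Data.Empty using (⊥-elim)
open import Data.Fin using (Fin; zero; suc)
open import Data.Fin.Properties using (any?; _≟_)
open import Data.Fin.Subset using (Subset; _∈_; _⊆_; _∪_)
open import Data.Fin.Subset.Properties using (_∈?_; x∈p∪q⁺; x∈p∪q⁻)
open import Data.List using (List; []; _∷_; filter; allFin)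
open import Data.List.Membership.Propositional using (find; lose)
open import Data.List.Membership.Propositional.Properties using (∈-allFin; ∈-filter⁺; ∈-filter⁻)
open import Data.List.Relation.Unary.Any as Any using (Any; here; there)
open import Data.Nat using (zero; suc)
open import Data.Product using (∃; _×_; _,_; proj₁; proj₂)
open import Data.Sum using (_⊎_; inj₁; inj₂)
open import Data.Vec using (lookup; tabulate)
open import Data.Vec.Properties using (lookup∘tabulate; lookup-zipWith; []=⇒lookup; lookup⇒[]=)
open import Function using (_⇔_; mk⇔; _∘_)
open import Relation.Binary using (Rel; _⇒_; Reflexive; Transitive; Decidable; IsEquivalence; IsTotalOrder; Poset)
open import Relation.Binary.PropositionalEquality as ≡ using (_≡_)
open import Relation.Nullary using (¬_; yes; no; does; contradiction)
open import Relation.Nullary.Decidable using (_×-dec_; _⊎-dec_; ⌊_⌋; T?; True; toWitness; fromWitness; dec-true; map′)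
open import Relation.Unary using () renaming (Decidable to Decidable₁)
open import Relation.Unary.Properties using (≐-refl; ≐-trans)
import Algebra.Properties.CommutativeMonoid.Sum as Sum
import Algebra.Properties.Ring as RingProperties
import Algebra.Properties.AbelianGroup as AbelianGroupProperties
import Relation.Binary.Reasoning.PartialOrder as PartialOrderReasoning
import Relation.Binary.Reasoning.Setoid as SetoidReasoning

-- Ordered-field arithmetic, absolute values and the logarithm.

module RealProperties (ℝ : RealNumbers) where
  open RealNumbers ℝ hiding (zero)
  open IsTotalOrder isTotalOrder public using (total; antisym)
    renaming (refl to ≤-refl; trans to ≤-trans; reflexive to ≤-reflexive)
  open RingProperties ring using (-‿distribˡ-*; -‿distribʳ-*; -‿involutive)
  open AbelianGroupProperties +-abelianGroup using (⁻¹-anti-homo‿-; //-rightDividesˡ; x≈y⇒x∙y⁻¹≈ε)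

  poset : Poset 0ℓ 0ℓ 0ℓ
  poset = record { isPartialOrder = IsTotalOrder.isPartialOrder isTotalOrder }

  module ≤-Reasoning = PartialOrderReasoning poset

  +-mono-≤ : ∀ {x y u v} → x ≤ y → u ≤ v → x + u ≤ y + v
  +-mono-≤ {x} {y} {u} {v} x≤y u≤v = begin
    x + u  ≤⟨ +-monoˡ-≤ u x≤y ⟩
    y + u  ≈⟨ +-comm y u ⟩
    u + y  ≤⟨ +-monoˡ-≤ y u≤v ⟩
    v + y  ≈⟨ +-comm v y ⟩
    y + v  ∎
    where open ≤-Reasoning

  0≤y-x⇒x≤y : ∀ {x y} → 0# ≤ y - x → x ≤ y
  0≤y-x⇒x≤y {x} {y} 0≤y-x = begin
    x            ≈⟨ +-identityˡ x ⟨
    0# + x       ≤⟨ +-monoˡ-≤ x 0≤y-x ⟩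
    (y - x) + x  ≈⟨ //-rightDividesˡ x y ⟩
    y            ∎
    where open ≤-Reasoning

  x≤y⇒0≤y-x : ∀ {x y} → x ≤ y → 0# ≤ y - x
  x≤y⇒0≤y-x {x} {y} x≤y = begin
    0#     ≈⟨ -‿inverseʳ x ⟨
    x - x  ≤⟨ +-monoˡ-≤ (- x) x≤y ⟩
    y - x  ∎
    where open ≤-Reasoning

  x≤0⇒0≤-x : ∀ {x} → x ≤ 0# → 0# ≤ - x
  x≤0⇒0≤-x {x} x≤0 = ≤-trans (x≤y⇒0≤y-x x≤0) (≤-reflexive (+-identityˡ (- x)))

  0≤x⇒-x≤0 : ∀ {x} → 0# ≤ x → - x ≤ 0#
  0≤x⇒-x≤0 {x} 0≤x = ≤-trans (≤-reflexive (sym (+-identityˡ (- x))))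
    (≤-trans (+-monoˡ-≤ (- x) 0≤x) (≤-reflexive (-‿inverseʳ x)))

  ∣x∣≤y : ∀ {x y} → x ≤ y → - x ≤ y → ∣ x ∣ ≤ y
  ∣x∣≤y {x} x≤y -x≤y with total 0# x
  ... | inj₁ _ = x≤y
  ... | inj₂ _ = -x≤y

  x≤∣x∣ : ∀ x → x ≤ ∣ x ∣
  x≤∣x∣ x with total 0# x
  ... | inj₁ _   = ≤-refl
  ... | inj₂ x≤0 = ≤-trans x≤0 (x≤0⇒0≤-x x≤0)

  -x≤∣x∣ : ∀ x → - x ≤ ∣ x ∣
  -x≤∣x∣ x with total 0# x
  ... | inj₁ 0≤x = ≤-trans (0≤x⇒-x≤0 0≤x) 0≤x
  ... | inj₂ _   = ≤-refl

  y-x≤∣x-y∣ : ∀ x y → y - x ≤ ∣ x - y ∣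
  y-x≤∣x-y∣ x y = ≤-trans (≤-reflexive (sym (⁻¹-anti-homo‿- x y))) (-x≤∣x∣ (x - y))

  ∣x-y∣≤z : ∀ {x y z} → x - y ≤ z → y - x ≤ z → ∣ x - y ∣ ≤ z
  ∣x-y∣≤z {x} {y} x-y≤z y-x≤z = ∣x∣≤y x-y≤z (≤-trans (≤-reflexive (⁻¹-anti-homo‿- x y)) y-x≤z)

  x≈y⇒∣x-y∣≤z : ∀ {x y z} → x ≈ y → 0# ≤ z → ∣ x - y ∣ ≤ z
  x≈y⇒∣x-y∣≤z x≈y 0≤z = ∣x-y∣≤z
    (≤-trans (≤-reflexive (x≈y⇒x∙y⁻¹≈ε x≈y)) 0≤z)
    (≤-trans (≤-reflexive (x≈y⇒x∙y⁻¹≈ε (sym x≈y))) 0≤z)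

  ∣x-y∣≤0⇒x≈y : ∀ {x y} → ∣ x - y ∣ ≤ 0# → x ≈ y
  ∣x-y∣≤0⇒x≈y {x} {y} ∣x-y∣≤0 = antisym
    (x-y≤0⇒x≤y (≤-trans (x≤∣x∣ (x - y)) ∣x-y∣≤0))
    (x-y≤0⇒x≤y (≤-trans (y-x≤∣x-y∣ x y) ∣x-y∣≤0))
    where
    x-y≤0⇒x≤y : ∀ {x y} → x - y ≤ 0# → x ≤ y
    x-y≤0⇒x≤y {x} {y} x-y≤0 = 0≤y-x⇒x≤y
      (≤-trans (x≤0⇒0≤-x x-y≤0) (≤-reflexive (⁻¹-anti-homo‿- x y)))

  [x-y]+[y-z]≈x-z : ∀ x y z → (x - y) + (y - z) ≈ x - z
  [x-y]+[y-z]≈x-z x y z = trans (sym (+-assoc (x - y) y (- z))) (+-congʳ (//-rightDividesˡ y x))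

  -- Both `x - z` and `z - x` telescope through `y`. This yields the bound `δ₁ + δ₂` on exit rates
  -- along a composition.
  ∣-∣-triangle : ∀ {x y z a b} → ∣ x - y ∣ ≤ a → ∣ y - z ∣ ≤ b → ∣ x - z ∣ ≤ a + b
  ∣-∣-triangle {x} {y} {z} {a} {b} xy yz = ∣x-y∣≤z
    (≤-trans (≤-reflexive (sym ([x-y]+[y-z]≈x-z x y z)))
      (+-mono-≤ (≤-trans (x≤∣x∣ _) xy) (≤-trans (x≤∣x∣ _) yz)))
    (≤-trans (≤-reflexive (trans (sym ([x-y]+[y-z]≈x-z z y x)) (+-comm (z - y) (y - x))))
      (+-mono-≤ (≤-trans (y-x≤∣x-y∣ x y) xy) (≤-trans (y-x≤∣x-y∣ y z) yz)))

  -x*-y≈x*y : ∀ x y → - x * - y ≈ x * y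
  -x*-y≈x*y x y = trans (sym (-‿distribˡ-* x (- y)))
    (trans (-‿cong (sym (-‿distribʳ-* x y))) (-‿involutive (x * y)))

  -- If `1# ≤ 0#`, then `- 1#` is nonnegative, and so is its square, which is `1#`.
  0≤1 : 0# ≤ 1#
  0≤1 with total 0# 1#
  ... | inj₁ 0≤1 = 0≤1
  ... | inj₂ 1≤0 = ≤-trans (*-nonNeg 0≤-1 0≤-1)
                     (≤-reflexive (trans (-x*-y≈x*y 1# 1#) (*-identityˡ 1#)))
    where 0≤-1 = x≤0⇒0≤-x 1≤0

  *-monoˡ-≤ : ∀ {x y z} → 0# ≤ z → x ≤ y → x * z ≤ y * z
  *-monoˡ-≤ {x} {y} {z} 0≤z x≤y = 0≤y-x⇒x≤y
    (≤-trans (*-nonNeg (x≤y⇒0≤y-x x≤y) 0≤z)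
      (≤-reflexive (trans (distribʳ z y (- x)) (+-congˡ (sym (-‿distribˡ-* x z))))))

  -- Were `y ≤ 0#`, multiplying by `x` would give `1# ≤ 0#`; were `y` zero, the product would
  -- vanish.
  x*y≈1⇒0<y : ∀ {x y} → 0# ≤ x → x * y ≈ 1# → 0# < y
  x*y≈1⇒0<y {x} {y} 0≤x xy≈1 = 0≤y , λ 0≈y → 0≉1 (trans (sym (zeroʳ x)) (trans (*-congˡ 0≈y) xy≈1))
    where
    0≤y : 0# ≤ y
    0≤y with total 0# y
    ... | inj₁ 0≤y = 0≤y
    ... | inj₂ y≤0 = contradiction (antisym 0≤1 1≤0) 0≉1
      where
      open ≤-Reasoning
      1≤0 : 1# ≤ 0#
      1≤0 = begin
        1#      ≈⟨ xy≈1 ⟨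
        x * y   ≈⟨ *-comm x y ⟩
        y * x   ≤⟨ *-monoˡ-≤ 0≤x y≤0 ⟩
        0# * x  ≈⟨ zeroˡ x ⟩
        0#      ∎

  -- With z = x / y, 0 ≈ ln x - ln y ≈ ln z ≤ z - 1 gives 1 ≤ z.
  ln-≈⇒≥ : ∀ {x y} → 0# < x → 0# < y → ln x ≈ ln y → y ≤ x
  ln-≈⇒≥ {x} {y} (0≤x , 0≉x) 0<y@(0≤y , 0≉y) lnx≈lny with inverse y (0≉y ∘ sym)
  ... | w , yw≈1 = begin
    y             ≈⟨ *-identityˡ y ⟨
    1# * y        ≤⟨ *-monoˡ-≤ 0≤y (0≤y-x⇒x≤y 0≤z-1) ⟩
    (x * w) * y   ≈⟨ zy≈x ⟩
    x             ∎
    where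
    open ≤-Reasoning
    zy≈x : (x * w) * y ≈ x
    zy≈x = trans (*-assoc x w y) (trans (*-congˡ (trans (*-comm w y) yw≈1)) (*-identityʳ x))
    0<z : 0# < x * w
    0<z = *-nonNeg 0≤x (proj₁ (x*y≈1⇒0<y 0≤y yw≈1)) ,
          λ 0≈z → 0≉x (trans (sym (zeroˡ y)) (trans (*-congʳ 0≈z) zy≈x))
    0≤z-1 : 0# ≤ x * w - 1#
    0≤z-1 = begin
      0#                           ≈⟨ -‿inverseʳ (ln y) ⟨
      ln y - ln y                  ≈⟨ +-congʳ lnx≈lny ⟨
      ln x - ln y                  ≈⟨ +-congʳ (ln-cong zy≈x) ⟨
      ln ((x * w) * y) - ln y      ≈⟨ +-congʳ (ln-* 0<z 0<y) ⟩
      (ln (x * w) + ln y) - ln y   ≈⟨ +-assoc (ln (x * w)) (ln y) (- ln y) ⟩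
      ln (x * w) + (ln y - ln y)   ≈⟨ +-congˡ (-‿inverseʳ (ln y)) ⟩
      ln (x * w) + 0#              ≈⟨ +-identityʳ (ln (x * w)) ⟩
      ln (x * w)                   ≤⟨ ln-≤ 0<z ⟩
      x * w - 1#                   ∎

  ln-injective : ∀ {x y} → 0# < x → 0# < y → ln x ≈ ln y → x ≈ y
  ln-injective 0<x 0<y lnx≈lny = antisym (ln-≈⇒≥ 0<y 0<x (sym lnx≈lny)) (ln-≈⇒≥ 0<x 0<y lnx≈lny)

  sum-mono-≤ : ∀ {n} {f g : Fin n → Carrier} → (∀ i → f i ≤ g i) → sum f ≤ sum g
  sum-mono-≤ {zero}  f≤g = ≤-refl
  sum-mono-≤ {suc n} f≤g = +-mono-≤ (f≤g zero) (sum-mono-≤ (f≤g ∘ suc))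

-- Membership in images and classes of decidable relations.

module _ {n q} {Q : Fin n → Set q} (Q? : Decidable₁ Q) where

  ∈-tabulate⁺ : ∀ {t} → Q t → t ∈ tabulate (λ u → does (Q? u))
  ∈-tabulate⁺ {t} Qt = lookup⇒[]= t _ (≡.trans (lookup∘tabulate _ t) (dec-true (Q? t) Qt))

  ∈-tabulate⁻ : ∀ {t} → t ∈ tabulate (λ u → does (Q? u)) → Q t
  ∈-tabulate⁻ {t} t∈ with Q? t | ≡.trans (≡.sym (lookup∘tabulate (λ u → does (Q? u)) t)) ([]=⇒lookup t∈)
  ... | yes Qt | _ = Qt
  ... | no  _  | ()

module _ {n r} {R : Rel (Fin n) r} (R? : Decidable R) where

  private
    Hits? : (A : Subset n) → Decidable₁ (λ t → ∃ λ s → s ∈ A × R s t)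
    Hits? A t = any? λ s → (s ∈? A) ×-dec R? s t

  ∈-image⁺ : ∀ {A s t} → s ∈ A → R s t → t ∈ image R? A
  ∈-image⁺ {A} {s} s∈A Rst = ∈-tabulate⁺ (Hits? A) (s , s∈A , Rst)

  ∈-image⁻ : ∀ {A t} → t ∈ image R? A → ∃ λ s → s ∈ A × R s t
  ∈-image⁻ {A} = ∈-tabulate⁻ (Hits? A)

  ∈-class⁺ : ∀ {u t} → R u t → t ∈ class R? u
  ∈-class⁺ {u} = ∈-tabulate⁺ (R? u)

  ∈-class⁻ : ∀ {u t} → t ∈ class R? u → R u t
  ∈-class⁻ {u} = ∈-tabulate⁻ (R? u)

image-mono : ∀ {n r r′} {R : Rel (Fin n) r} {R′ : Rel (Fin n) r′} (R? : Decidable R) (R′? : Decidable R′) →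
             R ⇒ R′ → ∀ {A} → image R? A ⊆ image R′? A
image-mono R? R′? R⇒R′ t∈ with ∈-image⁻ R? t∈
... | s , s∈A , Rst = ∈-image⁺ R′? s∈A (R⇒R′ Rst)

-- `R` may be any relation containing the composite, so the lemma serves both halves of the
-- symmetrised composition.
image-∘ : ∀ {n r₁ r₂ r} {R₁ : Rel (Fin n) r₁} {R₂ : Rel (Fin n) r₂} {R : Rel (Fin n) r}
          (R₁? : Decidable R₁) (R₂? : Decidable R₂) (R? : Decidable R) →
          (∀ {s t u} → R₁ s t → R₂ t u → R s u) →
          ∀ {A} → image R₂? (image R₁? A) ⊆ image R? A
image-∘ R₁? R₂? R? comp u∈ with ∈-image⁻ R₂? u∈
... | t , t∈ , R₂tu with ∈-image⁻ R₁? t∈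
...   | s , s∈A , R₁st = ∈-image⁺ R? s∈A (comp R₁st R₂tu)

module CTMCProperties {ℝ : RealNumbers} {AP : Set} (M : CTMC ℝ AP) where
  open RealNumbers ℝ hiding (reflexive; isEquivalence)
  open RealProperties ℝ
  open CTMC M
  open Bisimulation M
  open Sum +-commutativeMonoid using (sum-cong-≋; ∑-distrib-+; sum-replicate-zero)

  -- Monotonicity and additivity of A ↦ P(s, A).

  Pr-mono : ∀ s {A B} → A ⊆ B → Pr s A ≤ Pr s B
  Pr-mono s {A} {B} A⊆B = sum-mono-≤ pointwise
    where
    p = Distr.prob (P s)
    pointwise : ∀ t → (if lookup A t then p t else 0#) ≤ (if lookup B t then p t else 0#)
    pointwise t with lookup A t in eqA | lookup B t in eqB
    ... | true  | true  = ≤-refl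
    ... | false | true  = Distr.prob-nonNeg (P s) t
    ... | false | false = ≤-refl
    ... | true  | false with () ← ≡.trans (≡.sym eqB) ([]=⇒lookup (A⊆B (lookup⇒[]= t A eqA)))

  Pr-cong : ∀ s {A B} → A ⊆ B → B ⊆ A → Pr s A ≈ Pr s B
  Pr-cong s A⊆B B⊆A = antisym (Pr-mono s A⊆B) (Pr-mono s B⊆A)

  Pr-empty : ∀ s {A} → (∀ {t} → ¬ (t ∈ A)) → Pr s A ≈ 0#
  Pr-empty s {A} t∉A = trans (sum-cong-≋ pointwise) (sum-replicate-zero size)
    where
    p = Distr.prob (P s)
    pointwise : ∀ t → (if lookup A t then p t else 0#) ≈ 0#
    pointwise t with lookup A t in eqA
    ... | true  = ⊥-elim (t∉A (lookup⇒[]= t A eqA))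
    ... | false = refl

  Pr-∪ : ∀ s {A B} → (∀ {t} → t ∈ A → ¬ (t ∈ B)) → Pr s (A ∪ B) ≈ Pr s A + Pr s B
  Pr-∪ s {A} {B} A∩B=∅ = trans (sum-cong-≋ pointwise) (∑-distrib-+ {size} _ _)
    where
    p = Distr.prob (P s)
    pointwise : ∀ t → (if lookup (A ∪ B) t then p t else 0#) ≈
                      (if lookup A t then p t else 0#) + (if lookup B t then p t else 0#)
    -- After the rewrite, membership in the union is the Boolean disjunction of the two lookups;
    -- disjointness excludes the case where both are `true`, which would count `p t` twice.
    pointwise t rewrite lookup-zipWith _∨_ t A B with lookup A t in eqA | lookup B t in eqB
    ... | true  | true  = ⊥-elim (A∩B=∅ (lookup⇒[]= t A eqA) (lookup⇒[]= t B eqB))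
    ... | true  | false = sym (+-identityʳ (p t))
    ... | false | true  = sym (+-identityˡ (p t))
    ... | false | false = sym (+-identityʳ 0#)

  -- Unions of (ε,δ)-bisimulations and the largest one.

  -- Each related pair inherits its conditions from its own covering `B`; passing from `B` to `R`
  -- only enlarges the image of `A`. Reflexivity is a premise because the covers speak only of pairs
  -- already in `R`. The levels `r` and `b` are independent, so small relations can cover a large
  -- one.
  covered⇒approx : ∀ {r b ε δ} {R : Rel State r} → Decidable R → Reflexive R →
    (∀ {s t} → R s t → ∃ λ (B : Rel State b) → IsApproxBisimulation ε δ B × B s t × B ⇒ R) →
    IsApproxBisimulation ε δ R
  covered⇒approx {ε = ε} R? R-refl cover = record
    { decidable = R?
    ; reflexive = R-refl
    ; symmetric = λ Rst → let _ , isB , Bst , B⇒R = cover Rst in B⇒R (symmetric isB Bst)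
    ; labels    = λ Rst → let _ , isB , Bst , _ = cover Rst in labels isB Bst
    ; rates     = λ Rst → let _ , isB , Bst , _ = cover Rst in rates isB Bst
    ; probs     = λ {_} {t} Rst A → let _ , isB , Bst , B⇒R = cover Rst in
        ≤-trans (probs isB Bst A)
          (+-monoˡ-≤ ε (Pr-mono t (image-mono (decidable isB) R? B⇒R)))
    }
    where open IsApproxBisimulation

  -- Replacing `R` by the truth of its decision procedure moves it from level `r` to `Set`, where
  -- the witnesses of `∼[ ε , δ ]` must live.
  ⌊⌋-approx : ∀ {r ε δ} {R : Rel State r} (isR : IsApproxBisimulation ε δ R) →
    IsApproxBisimulation ε δ (λ s t → True (IsApproxBisimulation.decidable isR s t))
  ⌊⌋-approx isR = covered⇒approx (λ s t → T? _) (fromWitness reflexive)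
    λ Rst → _ , isR , toWitness Rst , fromWitness
    where open IsApproxBisimulation isR

  approx⇒∼ : ∀ {r ε δ} {R : Rel State r} → IsApproxBisimulation ε δ R → R ⇒ (λ s t → s ∼[ ε , δ ] t)
  approx⇒∼ isR Rst = _ , ⌊⌋-approx isR , fromWitness Rst

  -- Supplies the reflexivity of `∼[ ε , δ ]`; nonnegativity of `ε` and `δ` enters here.
  ≡-approx : ∀ {ε δ} → 0# ≤ ε → 0# ≤ δ → IsApproxBisimulation ε δ (_≡_ {A = State})
  ≡-approx {ε} {δ} 0≤ε 0≤δ = record
    { decidable = _≟_
    ; reflexive = ≡.refl
    ; symmetric = ≡.sym
    ; labels    = λ { ≡.refl → ≐-refl }
    ; rates     = λ { ≡.refl → x≈y⇒∣x-y∣≤z refl 0≤δ }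
    ; probs     = λ { {s} ≡.refl A → begin
        Pr s A                  ≤⟨ Pr-mono s (λ t∈A → ∈-image⁺ _≟_ t∈A ≡.refl) ⟩
        Pr s (image _≟_ A)      ≈⟨ +-identityʳ _ ⟨
        Pr s (image _≟_ A) + 0# ≤⟨ +-mono-≤ ≤-refl 0≤ε ⟩
        Pr s (image _≟_ A) + ε  ∎ }
    }
    where open ≤-Reasoning

  -- ∼[ ε , δ ] quantifies over relations and hence lives in Set₁, but decidable
  -- relations are Boolean matrices, which form a set to which `em` applies.
  ∼-decidable : ExcludedMiddle 0ℓ → ∀ ε δ → Decidable (λ s t → s ∼[ ε , δ ] t)
  ∼-decidable em ε δ s t = map′
    (λ (_ , isβ , βst) → _ , isβ , βst)
    (λ (_ , isR , Rst) → (λ u v → ⌊ IsApproxBisimulation.decidable isR u v ⌋) , ⌊⌋-approx isR , fromWitness Rst)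
    (em {∃ λ (β : State → State → Bool) → IsApproxBisimulation ε δ (λ u v → T (β u v)) × T (β s t)})

  ∼-approx : ExcludedMiddle 0ℓ → ∀ {ε δ} → 0# ≤ ε → 0# ≤ δ →
    IsApproxBisimulation ε δ (λ s t → s ∼[ ε , δ ] t)
  ∼-approx em {ε} {δ} 0≤ε 0≤δ = covered⇒approx (∼-decidable em ε δ)
    (approx⇒∼ (≡-approx 0≤ε 0≤δ) ≡.refl)
    -- The bisimulation witnessing a pair is its cover, and it lies inside `∼[ ε , δ ]` because it
    -- witnesses all of its other pairs too.
    λ (_ , isR , Rst) → _ , isR , Rst , approx⇒∼ isR

  -- Composition and additivity of the tolerances.

  -- Condition (iii) is applied to `A` along `R₁`, then to the set R₁(A) along `R₂`, and the errors
  -- add up.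
  probs-∘ : ∀ {r₁ r₂ ε₁ δ₁ ε₂ δ₂} {R₁ : Rel State r₁} {R₂ : Rel State r₂} →
    (is₁ : IsApproxBisimulation ε₁ δ₁ R₁) (is₂ : IsApproxBisimulation ε₂ δ₂ R₂) →
    let open IsApproxBisimulation in
    ∀ {s t u} → R₁ s t → R₂ t u → ∀ A →
    Pr s A ≤ Pr u (image (decidable is₂) (image (decidable is₁) A)) + (ε₁ + ε₂)
  probs-∘ {ε₁ = ε₁} {ε₂ = ε₂} is₁ is₂ {s} {t} {u} R₁st R₂tu A = begin
    Pr s A                 ≤⟨ probs is₁ R₁st A ⟩
    Pr t A₁ + ε₁           ≤⟨ +-monoˡ-≤ ε₁ (probs is₂ R₂tu A₁) ⟩
    (Pr u A₂ + ε₂) + ε₁    ≈⟨ +-assoc (Pr u A₂) ε₂ ε₁ ⟩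
    Pr u A₂ + (ε₂ + ε₁)    ≈⟨ +-congˡ (+-comm ε₂ ε₁) ⟩
    Pr u A₂ + (ε₁ + ε₂)    ∎
    where
    open IsApproxBisimulation
    open ≤-Reasoning
    A₁ = image (decidable is₁) A
    A₂ = image (decidable is₂) A₁

  -- R₁ ∘ R₂ alone need not be symmetric; its converse is R₂ ∘ R₁.
  module _ {r₁ r₂ ε₁ δ₁ ε₂ δ₂} {R₁ : Rel State r₁} {R₂ : Rel State r₂}
    (is₁ : IsApproxBisimulation ε₁ δ₁ R₁) (is₂ : IsApproxBisimulation ε₂ δ₂ R₂) where

    private
      module B₁ = IsApproxBisimulation is₁
      module B₂ = IsApproxBisimulation is₂

      R : Rel State _
      R s u = (∃ λ t → R₁ s t × R₂ t u) ⊎ (∃ λ t → R₂ s t × R₁ t u)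

      R? : Decidable R
      R? s u = any? (λ t → B₁.decidable s t ×-dec B₂.decidable t u)
               ⊎-dec any? (λ t → B₂.decidable s t ×-dec B₁.decidable t u)

    ∘-approx : IsApproxBisimulation (ε₁ + ε₂) (δ₁ + δ₂) R
    ∘-approx = record
      { decidable = R?
      ; reflexive = inj₁ (_ , B₁.reflexive , B₂.reflexive)
      ; symmetric = λ
          { (inj₁ (t , st , tu)) → inj₂ (t , B₂.symmetric tu , B₁.symmetric st)
          ; (inj₂ (t , st , tu)) → inj₁ (t , B₁.symmetric tu , B₂.symmetric st) }
      ; labels    = λ
          { (inj₁ (_ , st , tu)) → ≐-trans (B₁.labels st) (B₂.labels tu)
          ; (inj₂ (_ , st , tu)) → ≐-trans (B₂.labels st) (B₁.labels tu) }
      ; rates     = λ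
          { (inj₁ (_ , st , tu)) → ∣-∣-triangle (B₁.rates st) (B₂.rates tu)
          ; (inj₂ (_ , st , tu)) → ≤-trans (∣-∣-triangle (B₂.rates st) (B₁.rates tu))
                                     (≤-reflexive (+-comm δ₂ δ₁)) }
      ; probs     = λ
          { {_} {u} (inj₁ (_ , st , tu)) A → ≤-trans (probs-∘ is₁ is₂ st tu A)
              (+-monoˡ-≤ _ (Pr-mono u (image-∘ B₁.decidable B₂.decidable R?
                (λ st tu → inj₁ (_ , st , tu)))))
          ; {_} {u} (inj₂ (_ , st , tu)) A → ≤-trans (probs-∘ is₂ is₁ st tu A)
              (+-mono-≤ (Pr-mono u (image-∘ B₂.decidable B₁.decidable R?
                (λ st tu → inj₂ (_ , st , tu)))) (≤-reflexive (+-comm ε₂ ε₁))) }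
      }

  ∼-trans : ∀ {ε₁ δ₁ ε₂ δ₂ s t u} → s ∼[ ε₁ , δ₁ ] t → t ∼[ ε₂ , δ₂ ] u →
    s ∼[ ε₁ + ε₂ , δ₁ + δ₂ ] u
  ∼-trans (_ , is₁ , st) (_ , is₂ , tu) = approx⇒∼ (∘-approx is₁ is₂) (inj₁ (_ , st , tu))

  -- Needed for transitivity of `∼[ 0# , 0# ]`: composition gives the tolerance `0# + 0#`, which
  -- equals `0#` only up to `≈`.
  approx-resp-≤ : ∀ {r ε ε′ δ δ′} {R : Rel State r} → ε ≤ ε′ → δ ≤ δ′ →
    IsApproxBisimulation ε δ R → IsApproxBisimulation ε′ δ′ R
  approx-resp-≤ ε≤ε′ δ≤δ′ isR = record
    { decidable = decidable
    ; reflexive = reflexive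
    ; symmetric = symmetric
    ; labels    = labels
    ; rates     = λ Rst → ≤-trans (rates Rst) δ≤δ′
    ; probs     = λ Rst A → ≤-trans (probs Rst A) (+-mono-≤ ≤-refl ε≤ε′)
    }
    where open IsApproxBisimulation isR

  -- Strong bisimulations and (0,0)-bisimulations.

  module _ {r} {R : Rel State r} (isR : IsStrongBisimulation R) where
    open IsStrongBisimulation isR
    private module Eq = IsEquivalence isEquivalence

    -- This is R(A) for the set A of listed states; the list allows induction over the generating
    -- states.
    saturation : List State → Subset size
    saturation us = tabulate (λ t → does (Any.any? (λ u → decidable u t) us))

    private
      sat⁺ : ∀ us {t} → Any (λ u → R u t) us → t ∈ saturation us
      sat⁺ us = ∈-tabulate⁺ (λ t → Any.any? (λ u → decidable u t) us)

      sat⁻ : ∀ us {t} → t ∈ saturation us → Any (λ u → R u t) us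
      sat⁻ us = ∈-tabulate⁻ (λ t → Any.any? (λ u → decidable u t) us)

    -- Each u contributes either no new state or a whole class disjoint from the rest.
    Pr-saturation : ∀ {s s′} → R s s′ → ∀ us → Pr s (saturation us) ≈ Pr s′ (saturation us)
    Pr-saturation {s} {s′} Rss′ [] = trans (Pr-empty s empty) (sym (Pr-empty s′ empty))
      where
      empty : ∀ {t} → ¬ (t ∈ saturation [])
      empty t∈ with () ← sat⁻ [] t∈
    Pr-saturation {s} {s′} Rss′ (u ∷ us) with Any.any? (λ v → decidable v u) us
    ... | yes Rvu = begin
      Pr s  (saturation (u ∷ us))  ≈⟨ Pr-cong s absorb grow ⟩
      Pr s  (saturation us)        ≈⟨ Pr-saturation Rss′ us ⟩
      Pr s′ (saturation us)        ≈⟨ Pr-cong s′ absorb grow ⟨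
      Pr s′ (saturation (u ∷ us))  ∎
      where
      open SetoidReasoning setoid
      grow : saturation us ⊆ saturation (u ∷ us)
      grow = sat⁺ (u ∷ us) ∘ there ∘ sat⁻ us
      absorb : saturation (u ∷ us) ⊆ saturation us
      absorb t∈ with sat⁻ (u ∷ us) t∈
      -- Some listed `v` is related to `u`, hence by transitivity to everything in the class of `u`.
      ... | here Rut  = sat⁺ us (Any.map (λ Rvu → Eq.trans Rvu Rut) Rvu)
      ... | there Rvt = sat⁺ us Rvt
    ... | no ¬Rvu = begin
      Pr s  (saturation (u ∷ us))                ≈⟨ split s ⟩
      Pr s  (class decidable u) + Pr s  (saturation us)  ≈⟨ +-cong (probs Rss′ u) (Pr-saturation Rss′ us) ⟩
      Pr s′ (class decidable u) + Pr s′ (saturation us)  ≈⟨ split s′ ⟨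
      Pr s′ (saturation (u ∷ us))                ∎
      where
      open SetoidReasoning setoid
      to : saturation (u ∷ us) ⊆ class decidable u ∪ saturation us
      to t∈ with sat⁻ (u ∷ us) t∈
      ... | here Rut  = x∈p∪q⁺ (inj₁ (∈-class⁺ decidable Rut))
      ... | there Rvt = x∈p∪q⁺ (inj₂ (sat⁺ us Rvt))
      from : class decidable u ∪ saturation us ⊆ saturation (u ∷ us)
      from t∈ with x∈p∪q⁻ (class decidable u) (saturation us) t∈
      ... | inj₁ t∈class = sat⁺ (u ∷ us) (here (∈-class⁻ decidable t∈class))
      ... | inj₂ t∈sat   = sat⁺ (u ∷ us) (there (sat⁻ us t∈sat))
      split : ∀ v → Pr v (saturation (u ∷ us)) ≈ Pr v (class decidable u) + Pr v (saturation us)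
      -- A state shared by the class of `u` and the saturation of `us` would relate a listed state
      -- to `u`, against `¬Rvu`.
      split v = trans (Pr-cong v to from) (Pr-∪ v λ t∈class t∈sat →
        ¬Rvu (Any.map (λ Rvt → Eq.trans Rvt (Eq.sym (∈-class⁻ decidable t∈class))) (sat⁻ us t∈sat)))

    Pr-image : ∀ {s s′} → R s s′ → ∀ A → Pr s (image decidable A) ≈ Pr s′ (image decidable A)
    Pr-image {s} {s′} Rss′ A = begin
      Pr s  (image decidable A)  ≈⟨ Pr-cong s to from ⟩
      Pr s  (saturation us)      ≈⟨ Pr-saturation Rss′ us ⟩
      Pr s′ (saturation us)      ≈⟨ Pr-cong s′ to from ⟨
      Pr s′ (image decidable A)  ∎
      where
      open SetoidReasoning setoid
      -- The members of `A` as a list, whose saturation is R(A).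
      us = filter (_∈? A) (allFin size)
      to : image decidable A ⊆ saturation us
      to t∈ with ∈-image⁻ decidable t∈
      ... | v , v∈A , Rvt = sat⁺ us (lose (∈-filter⁺ (_∈? A) (∈-allFin v) v∈A) Rvt)
      from : saturation us ⊆ image decidable A
      from t∈ with find (sat⁻ us t∈)
      ... | v , v∈us , Rvt = ∈-image⁺ decidable (proj₂ (∈-filter⁻ (_∈? A) {xs = allFin size} v∈us)) Rvt

    strong⇒approx : IsApproxBisimulation 0# 0# R
    strong⇒approx = record
      { decidable = decidable
      ; reflexive = Eq.refl
      ; symmetric = Eq.sym
      ; labels    = labels
      ; rates     = λ Rst → x≈y⇒∣x-y∣≤z (ln-cong (rates Rst)) ≤-refl
      ; probs     = λ {s} {s′} Rss′ A → begin
          Pr s A                          ≤⟨ Pr-mono s (λ t∈A → ∈-image⁺ decidable t∈A Eq.refl) ⟩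
          Pr s (image decidable A)        ≈⟨ Pr-image Rss′ A ⟩
          Pr s′ (image decidable A)       ≈⟨ +-identityʳ _ ⟨
          Pr s′ (image decidable A) + 0#  ∎
      }
      where open ≤-Reasoning

  -- Transitivity makes `R` an equivalence and gives R(C) ⊆ C for each class C, so condition (iii)
  -- at tolerance zero compares P(s, C) with P(s′, C); symmetry of `R` reverses the inequality.
  approx⇒strong : ∀ {r} {R : Rel State r} → Transitive R →
    IsApproxBisimulation 0# 0# R → IsStrongBisimulation R
  approx⇒strong {R = R} R-trans isR = record
    { decidable     = decidable
    ; isEquivalence = record { refl = reflexive ; sym = symmetric ; trans = R-trans }
    ; labels        = labels
    ; rates         = λ {s} {s′} Rss′ →
        ln-injective (E-pos s) (E-pos s′) (∣x-y∣≤0⇒x≈y (rates Rss′))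
    ; probs         = λ Rss′ u → antisym (class-≤ Rss′ u) (class-≤ (symmetric Rss′) u)
    }
    where
    open IsApproxBisimulation isR
    open ≤-Reasoning

    image-class : ∀ u → image decidable (class decidable u) ⊆ class decidable u
    image-class u t∈ with ∈-image⁻ decidable t∈
    ... | v , v∈ , Rvt = ∈-class⁺ decidable (R-trans (∈-class⁻ decidable v∈) Rvt)

    class-≤ : ∀ {s s′} → R s s′ → ∀ u → Pr s (class decidable u) ≤ Pr s′ (class decidable u)
    class-≤ {s} {s′} Rss′ u = begin
      Pr s C                          ≤⟨ probs Rss′ C ⟩
      Pr s′ (image decidable C) + 0#  ≈⟨ +-identityʳ _ ⟩
      Pr s′ (image decidable C)       ≤⟨ Pr-mono s′ (image-class u) ⟩
      Pr s′ C                         ∎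
      where C = class decidable u

  ∼⇔∼[0,0] : ExcludedMiddle 0ℓ → ∀ {s s′} → (s ∼ s′) ⇔ (s ∼[ 0# , 0# ] s′)
  ∼⇔∼[0,0] em = mk⇔
    (λ (_ , isR , Rss′) → _ , strong⇒approx isR , Rss′)
    -- The strong bisimulation is the Boolean form of `∼[ 0# , 0# ]`, since `∼` asks for a relation
    -- in `Set`; transitivity is transported through `toWitness` and `fromWitness`.
    (λ s∼s′ → _ , approx⇒strong (λ s∼t t∼u → fromWitness (∼₀-trans (toWitness s∼t) (toWitness t∼u)))
                    (⌊⌋-approx (∼-approx em ≤-refl ≤-refl))
                , fromWitness s∼s′)
    where
    0+0≤0 : 0# + 0# ≤ 0#
    0+0≤0 = ≤-reflexive (+-identityʳ 0#)

    ∼₀-trans : Transitive (λ s t → s ∼[ 0# , 0# ] t)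
    ∼₀-trans s∼t t∼u with ∼-trans s∼t t∼u
    ... | _ , isR , Rsu = _ , approx-resp-≤ 0+0≤0 0+0≤0 isR , Rsu

theorem2 : ExcludedMiddle 0ℓ → ∀ {r : Level} (ℝ : RealNumbers) {AP : Set} (M : CTMC ℝ AP) →
    let open RealNumbers ℝ
        open CTMC M
        open Bisimulation M
    in (ε δ ε₁ δ₁ ε₂ δ₂ : Carrier) →
       0# ≤ ε → 0# ≤ δ → 0# ≤ ε₁ → 0# ≤ δ₁ → 0# ≤ ε₂ → 0# ≤ δ₂ →
       (s s′ s″ : State) →
       (IsApproxBisimulation ε δ (λ t t′ → t ∼[ ε , δ ] t′)
         × ((R : Rel State r) → IsApproxBisimulation ε δ R → R ⇒ (λ t t′ → t ∼[ ε , δ ] t′)))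
       × (s ∼[ ε₁ , δ₁ ] s′ → s′ ∼[ ε₂ , δ₂ ] s″ → s ∼[ ε₁ + ε₂ , δ₁ + δ₂ ] s″)
       × ((s ∼ s′) ⇔ (s ∼[ 0# , 0# ] s′))
theorem2 em ℝ M ε δ ε₁ δ₁ ε₂ δ₂ 0≤ε 0≤δ _ _ _ _ s s′ s″ =
  (∼-approx em 0≤ε 0≤δ , λ _ → approx⇒∼) , ∼-trans , ∼⇔∼[0,0] em
  where open CTMCProperties M
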